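{- Let $\lambda$ be a unit computon. Up to isomorphism, $\lambda$ is the left- and right-identity for both total and partial sequencing. That is, for every computon $\lambda_1$ (in the same computon category): (1) for every sequentiable span $\rho_1 := (\lambda \xleftarrow{\alpha} \lambda_0 \xrightarrow{\alpha_1} \lambda_1)$, the sequential computon given by its pushout (which is $\lambda \unrhd_{\rho_1} \lambda_1$ when it is total, and $\lambda \rhd_{\rho_1} \lambda_1$ when it is partial) is isomorphic to $\lambda_1$; (2) for every sequentiable span $\rho_2 := (\lambda_1 \xleftarrow{\alpha_1} \lambda_0 \xrightarrow{\alpha} \lambda)$, the sequential computon given by its pushout (which is $\lambda_1 \unrhd_{\rho_2} \lambda$ when it is total, and $\lambda_1 \rhd_{\rho_2} \lambda$ when it is partial) is isomorphic to $\lambda_1$.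
   Context: Fix $n\ge 1$, the set of types $\underline{n}:=\{0,1,\dots,n-1\}$ (type $0$ is the control type), and a finite nonempty set $B\subset\Sigma^*$ of computing devices over a finite alphabet $\Sigma$, with a distinguished element $\epsilon\in B$. All computons are over these fixed $\underline{n}$ and $B$. **Computon.** A computon $\lambda$ is a tuple $(U,P,I,O,\underline{n},B,\sigma,t,\tau,s,c,r,f)$ where $U$ (computation units), $I$ (inflows), $O$ (outflows) are finite sets, $P$ (ports) is a finite nonempty set, $\sigma\colon O\to U$, $\tau\colon I\to U$ and $r\colon I\to O$ are surjective functions, and $t\colon O\to P$, $s\colon I\to P$, $c\colon P\to\underline{n}$, $f\colon O\to B$ are functions, such that: the restrictions of $\tau$ to $(c\circ s)^{ -1}(0)$ and of $\sigma$ to $(c\circ t)^{ -1}(0)$ are surjective onto $U$; $\sigma\circ r=\tau$; and there exist $p\in P\setminus t(O)$ and $q\in P\setminus s(I)$ with $c(p)=0=c(q)$. Components of a computon $\lambda_k$ carry the index $k$. Write $P^+:=P\setminus t(O)$ (inports), $P^-:=P\setminus s(I)$ (outports), and for $p\in P$ write $p\bullet:=\tau(s^{ -1}(p))$ and $\bullet p:=\sigma(t^{ -1}(p))$. **Morphism.** A computon morphism $\alpha\colon\lambda_1\to\lambda_2$ consists of functions $\alpha_U\colon U_1\to U_2$, $\alpha_P\colon P_1\to P_2$, $\alpha_I\colon I_1\to I_2$, $\alpha_O\colon O_1\to O_2$ and the inclusions (identities) on $\underline{n}$ and on $B$, such that $\alpha_U\tau_1=\tau_2\alpha_I$, $\alpha_U\sigma_1=\sigma_2\alpha_O$,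 $\alpha_P s_1=s_2\alpha_I$, $\alpha_P t_1=t_2\alpha_O$, $\alpha_O r_1=r_2\alpha_I$, $f_2\alpha_O=f_1$, $c_2\alpha_P=c_1$, and $\vec{i}(\alpha)\cup\vec{o}(\alpha)\subseteq P_1^+\cup P_1^-$, where $\vec{i}(\alpha)=\{p\in P_1\mid \bullet\alpha_P(p)\setminus\alpha_U(\bullet p)\ne\emptyset\}$ and $\vec{o}(\alpha)=\{p\in P_1\mid \alpha_P(p)\bullet\setminus\alpha_U(p\bullet)\neq\emptyset\}$. Morphisms compose componentwise; a monomorphism is a morphism all of whose components are injective; isomorphism $\cong$ means isomorphism in this category. **Trivial and unit computons.** A computon is trivial if $U=I=O=\emptyset$. A unit computon is a trivial computon with $|P|=1$ (its unique port necessarily has type $0$). **Pushout.** The pushout $\lambda_1+_{\lambda_0}\lambda_2$ of a span $\lambda_1\xleftarrow{\alpha_1}\lambda_0\xrightarrow{\alpha_2}\lambda_2$ is formed componentwise: its sets of units, ports, inflows and outflows are the pushouts of finite sets $U_1\sqcup_{U_0}U_2$, $P_1\sqcup_{P_0}P_2$, $I_1\sqcup_{I_0}I_2$, $O_1\sqcup_{O_0}O_2$, and its structure functions are the induced ones (over the same $\underline{n}$ and $B$). For the spans below this is a computon and is the categorical pushout. **Sequencing.** A span $\lambda_1\xleftarrow{\alpha_1}\lambda_0\xrightarrow{\alpha_2}\lambda_2$ is sequentiable if $\lambda_0$ is a trivial computon and $\alpha_1,\alpha_2$ are monomorphisms with $\alpha_1(P_0)\subseteq P_1^-$ and $\alpha_2(P_0)\subseteq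 P_2^+$. The pushout of a sequentiable span $\rho$ is called the total sequential computon $\lambda_1\unrhd_\rho\lambda_2$ if $\alpha_1(P_0)=P_1^-$ and $\alpha_2(P_0)=P_2^+$; otherwise it is called the partial sequential computon $\lambda_1\rhd_\rho\lambda_2$. -}

module Defs where

open import Data.Bool using (Bool; true; false)
open import Data.Fin using (Fin; zero; suc; toℕ; punchIn; punchOut)
open import Data.Fin.Properties using (_≟_; +↔⊎; any?; all?; punchIn-punchOut; punchOut-punchIn; punchOut-cong; punchInᵢ≢i)
open import Data.List using (List)
open import Data.List.Membership.Propositional using () renaming (_∈_ to _∈ᴸ_)
open import Data.Nat using (ℕ; zero; suc; _+_; NonZero)
open import Data.Product using (∃; _×_; _,_)
open import Data.Sum using (_⊎_; inj₁; inj₂; [_,_]′)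
open import Data.Sum.Function.Propositional using (_⊎-↔_)
open import Function using (_∘_; id; const; _↔_; Inverse; Injective; StrictlySurjective)
open import Function.Construct.Composition using (_↔-∘_)
open import Function.Construct.Identity using (↔-id)
open import Function.Construct.Symmetry using (↔-sym)
open import Relation.Binary using (DecidableEquality)
open import Relation.Binary.PropositionalEquality
  using (_≡_; _≢_; _≗_; refl; sym; trans; cong; subst)
open import Level using (0ℓ)
open import Relation.Nullary using (¬_; Dec; yes; no; contradiction)
open import Relation.Nullary.Decidable using (⌊_⌋; map′; _→-dec_; _×-dec_; _⊎-dec_; ¬?)
open import Relation.Unary using (Pred; Decidable; _∈_; _∉_; _⊆_; _≐_; _∪_; _∖_; Satisfiable)

------------------------------------------------------------------------
-- Finite sets

record FinSet : Set₁ where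
  field
    Carrier     : Set
    size        : ℕ
    enumeration : Carrier ↔ Fin size

  open Inverse enumeration public
    using () renaming (to to index; from to element; strictlyInverseˡ to index-element; strictlyInverseʳ to element-index)

  ≡-dec : DecidableEquality Carrier
  ≡-dec x y = map′ (λ e → trans (sym (element-index x)) (trans (cong element e) (element-index y)))
                   (cong index) (index x ≟ index y)

  ∃? : {Q : Pred Carrier 0ℓ} → Decidable Q → Dec (∃ Q)
  ∃? {Q} Q? = map′ (λ (k , q) → element k , q)
                   (λ (x , q) → index x , subst Q (sym (element-index x)) q)
                   (any? (Q? ∘ element))

  ∀? : {Q : Pred Carrier 0ℓ} → Decidable Q → Dec (∀ x → Q x)
  ∀? {Q} Q? = map′ (λ q x → subst Q (element-index x) (q (index x)))
                   (λ q k → q (element k))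
                   (all? (Q? ∘ element))

open FinSet using (size; index; element; index-element; element-index; ≡-dec; ∃?; ∀?) renaming (Carrier to ∣_∣)

finSet : ℕ → FinSet
finSet k = record { Carrier = Fin k ; size = k ; enumeration = ↔-id (Fin k) }

infixr 1 _⊎ᶠ_

_⊎ᶠ_ : FinSet → FinSet → FinSet
X ⊎ᶠ Y = record
  { Carrier     = ∣ X ∣ ⊎ ∣ Y ∣
  ; size        = size X + size Y
  ; enumeration = ↔-sym +↔⊎ ↔-∘ (FinSet.enumeration X ⊎-↔ FinSet.enumeration Y)
  }

Empty : FinSet → Set
Empty X = ¬ ∣ X ∣

image : {A B : Set} → (A → B) → Pred A 0ℓ → Pred B 0ℓ
image f S y = ∃ λ x → x ∈ S × f x ≡ y

range : {A B : Set} → (A → B) → Pred B 0ℓ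
range f y = ∃ λ x → f x ≡ y

range? : (X Y : FinSet) (f : ∣ X ∣ → ∣ Y ∣) → Decidable (range f)
range? X Y f y = ∃? X (λ x → ≡-dec Y (f x) y)

⌊⌋-true : {A : Set} (a? : Dec A) → ⌊ a? ⌋ ≡ true → A
⌊⌋-true (yes a) _ = a

true-⌊⌋ : {A : Set} (a? : Dec A) → A → ⌊ a? ⌋ ≡ true
true-⌊⌋ (yes _) _ = refl
true-⌊⌋ (no ¬a) a = contradiction a ¬a

⌊⌋-⇔ : {A A′ : Set} (a? : Dec A) (a′? : Dec A′) → (A → A′) → (A′ → A) → ⌊ a? ⌋ ≡ ⌊ a′? ⌋
⌊⌋-⇔ (yes _) (yes _)  _ _ = refl
⌊⌋-⇔ (yes a) (no ¬a′) f _ = contradiction (f a) ¬a′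
⌊⌋-⇔ (no ¬a) (yes a′) _ g = contradiction (g a′) ¬a
⌊⌋-⇔ (no _)  (no _)   _ _ = refl

------------------------------------------------------------------------
-- Coequalizers of finite sets, by identifying one pair of points at a time

record Coequalizer {a m : ℕ} (f g : Fin a → Fin m) : Set₁ where
  field
    card      : ℕ
    quot      : Fin m → Fin card
    rep       : Fin card → Fin m
    quot-rep  : quot ∘ rep ≗ id
    quot-glue : quot ∘ f ≗ quot ∘ g
    rep-quot  : {X : Set} (h : Fin m → X) → h ∘ f ≗ h ∘ g → h ∘ rep ∘ quot ≗ h

private
  module Merge {m : ℕ} {x y : Fin (suc m)} (x≢y : x ≢ y) where

    collapse : Fin (suc m) → Fin m
    collapse z with x ≟ z
    ... | yes _   = punchOut x≢y
    ... | no x≢z  = punchOut x≢z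

    collapse-punchIn : ∀ k → collapse (punchIn x k) ≡ k
    collapse-punchIn k with x ≟ punchIn x k
    ... | yes e   = contradiction (sym e) (punchInᵢ≢i x k)
    ... | no x≢z  = trans (punchOut-cong x refl) (punchOut-punchIn x)

    collapse-glue : collapse x ≡ collapse y
    collapse-glue with x ≟ x | x ≟ y
    ... | no x≢x | _       = contradiction refl x≢x
    ... | yes _  | yes x≡y = contradiction x≡y x≢y
    ... | yes _  | no _    = punchOut-cong x refl

    punchIn-collapse : {X : Set} (h : Fin (suc m) → X) → h x ≡ h y → ∀ z → h (punchIn x (collapse z)) ≡ h z
    punchIn-collapse h hx≡hy z with x ≟ z
    ... | yes refl = trans (cong h (punchIn-punchOut x≢y)) (sym hx≡hy)
    ... | no x≢z   = cong h (punchIn-punchOut x≢z)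

coequalizer : {a m : ℕ} (f g : Fin a → Fin m) → Coequalizer f g
coequalizer {zero} {m} f g = record
  { card      = m
  ; quot      = id
  ; rep       = id
  ; quot-rep  = λ _ → refl
  ; quot-glue = λ ()
  ; rep-quot  = λ _ _ _ → refl
  }
coequalizer {suc a} {zero} f g with f zero
... | ()
coequalizer {suc a} {suc m} f g with f zero ≟ g zero
... | yes f₀≡g₀ = record
  { card      = card
  ; quot      = quot
  ; rep       = rep
  ; quot-rep  = quot-rep
  ; quot-glue = λ { zero → cong quot f₀≡g₀ ; (suc i) → quot-glue i }
  ; rep-quot  = λ h e → rep-quot h (e ∘ suc)
  }
  where open Coequalizer (coequalizer (f ∘ suc) (g ∘ suc))
... | no f₀≢g₀ = record
  { card      = card
  ; quot      = quot ∘ collapse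
  ; rep       = punchIn (f zero) ∘ rep
  ; quot-rep  = λ k → trans (cong quot (collapse-punchIn (rep k))) (quot-rep k)
  ; quot-glue = λ { zero → cong quot collapse-glue ; (suc i) → quot-glue i }
  ; rep-quot  = λ h e z →
      let h′ = h ∘ punchIn (f zero)
          h′-collapse = punchIn-collapse h (e zero)
      in trans (rep-quot h′ (λ i → trans (h′-collapse (f (suc i)))
                                         (trans (e (suc i)) (sym (h′-collapse (g (suc i))))))
                         (collapse z))
               (h′-collapse z)
  }
  where
  open Merge f₀≢g₀
  open Coequalizer (coequalizer (collapse ∘ f ∘ suc) (collapse ∘ g ∘ suc))

------------------------------------------------------------------------
-- Pushouts of finite sets

record Pushout {X Y Z : FinSet} (f : ∣ X ∣ → ∣ Y ∣) (g : ∣ X ∣ → ∣ Z ∣) : Set₁ where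
  field
    apex    : FinSet
    in₁     : ∣ Y ∣ → ∣ apex ∣
    in₂     : ∣ Z ∣ → ∣ apex ∣
    commute : in₁ ∘ f ≗ in₂ ∘ g
    copair  : {W : Set} (h : ∣ Y ∣ → W) (k : ∣ Z ∣ → W) → h ∘ f ≗ k ∘ g → ∣ apex ∣ → W
    copair₁ : {W : Set} (h : ∣ Y ∣ → W) (k : ∣ Z ∣ → W) (e : h ∘ f ≗ k ∘ g) → copair h k e ∘ in₁ ≗ h
    copair₂ : {W : Set} (h : ∣ Y ∣ → W) (k : ∣ Z ∣ → W) (e : h ∘ f ≗ k ∘ g) → copair h k e ∘ in₂ ≗ k
    unique  : {W : Set} (u v : ∣ apex ∣ → W) → u ∘ in₁ ≗ v ∘ in₁ → u ∘ in₂ ≗ v ∘ in₂ → u ≗ v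

  cover : ∀ z → z ∈ range in₁ ∪ range in₂
  cover z = ⌊⌋-true (covered? z) (unique (⌊_⌋ ∘ covered?) (const true)
      (λ y → true-⌊⌋ (covered? (in₁ y)) (inj₁ (y , refl)))
      (λ y → true-⌊⌋ (covered? (in₂ y)) (inj₂ (y , refl))) z)
    where
    covered? : Decidable (range in₁ ∪ range in₂)
    covered? w = range? Y apex in₁ w ⊎-dec range? Z apex in₂ w

  in₁≡in₂⇒∈range₁ : ∀ {y z} → in₁ y ≡ in₂ z → y ∈ range f
  in₁≡in₂⇒∈range₁ {y} {z} e = ⌊⌋-true (f? y)
      (trans (sym (copair₁ (⌊_⌋ ∘ f?) (const true) compat y))
             (trans (cong (copair (⌊_⌋ ∘ f?) (const true) compat) e)
                    (copair₂ (⌊_⌋ ∘ f?) (const true) compat z)))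
    where
    f? : Decidable (range f)
    f? = range? X Y f
    compat : ∀ x → ⌊ f? (f x) ⌋ ≡ true
    compat x = true-⌊⌋ (f? (f x)) (x , refl)

  in₁≡in₂⇒∈range₂ : ∀ {y z} → in₁ y ≡ in₂ z → z ∈ range g
  in₁≡in₂⇒∈range₂ {y} {z} e = ⌊⌋-true (g? z)
      (trans (sym (copair₂ (const true) (⌊_⌋ ∘ g?) compat z))
             (trans (cong (copair (const true) (⌊_⌋ ∘ g?) compat) (sym e))
                    (copair₁ (const true) (⌊_⌋ ∘ g?) compat y)))
    where
    g? : Decidable (range g)
    g? = range? X Z g
    compat : ∀ x → true ≡ ⌊ g? (g x) ⌋
    compat x = sym (true-⌊⌋ (g? (g x)) (x , refl))

  in₁-injective : Injective _≡_ _≡_ g → Injective _≡_ _≡_ in₁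
  in₁-injective g-inj {y} {y′} e = sym (⌊⌋-true (≡-dec Y y′ y)
      (trans (sym (copair₁ h k compat y′))
      (trans (cong (copair h k compat) (sym e))
      (trans (copair₁ h k compat y) (true-⌊⌋ (≡-dec Y y y) refl)))))
    where
    k? : ∀ z → Dec (∃ λ x → g x ≡ z × f x ≡ y)
    k? z = ∃? X (λ x → ≡-dec Z (g x) z ×-dec ≡-dec Y (f x) y)
    h : ∣ Y ∣ → Bool
    h w = ⌊ ≡-dec Y w y ⌋
    k : ∣ Z ∣ → Bool
    k z = ⌊ k? z ⌋
    compat : h ∘ f ≗ k ∘ g
    compat x = ⌊⌋-⇔ (≡-dec Y (f x) y) (k? (g x)) (λ p → x , refl , p)
                     (λ (x′ , p , p′) → trans (cong f (sym (g-inj p))) p′)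

  in₂-injective : Injective _≡_ _≡_ f → Injective _≡_ _≡_ in₂
  in₂-injective f-inj {z} {z′} e = sym (⌊⌋-true (≡-dec Z z′ z)
      (trans (sym (copair₂ h k compat z′))
      (trans (cong (copair h k compat) (sym e))
      (trans (copair₂ h k compat z) (true-⌊⌋ (≡-dec Z z z) refl)))))
    where
    h? : ∀ y → Dec (∃ λ x → f x ≡ y × g x ≡ z)
    h? y = ∃? X (λ x → ≡-dec Y (f x) y ×-dec ≡-dec Z (g x) z)
    h : ∣ Y ∣ → Bool
    h y = ⌊ h? y ⌋
    k : ∣ Z ∣ → Bool
    k w = ⌊ ≡-dec Z w z ⌋
    compat : h ∘ f ≗ k ∘ g
    compat x = sym (⌊⌋-⇔ (≡-dec Z (g x) z) (h? (f x)) (λ p → x , refl , p)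
                          (λ (x′ , p , p′) → trans (cong g (sym (f-inj p))) p′))

pushoutOf : {X Y Z : FinSet} (f : ∣ X ∣ → ∣ Y ∣) (g : ∣ X ∣ → ∣ Z ∣) → Pushout {X} {Y} {Z} f g
pushoutOf {X} {Y} {Z} f g = record
  { apex    = finSet card
  ; in₁     = q ∘ inj₁
  ; in₂     = q ∘ inj₂
  ; commute = λ x → subst (λ w → q (inj₁ (f w)) ≡ q (inj₂ (g w))) (element-index X x) (quot-glue (index X x))
  ; copair  = λ h k _ → [ h , k ]′ ∘ r
  ; copair₁ = λ h k e y → r-q h k e (inj₁ y)
  ; copair₂ = λ h k e z → r-q h k e (inj₂ z)
  ; unique  = λ u v e₁ e₂ w → trans (sym (cong u (q-r w))) (trans (agree u v e₁ e₂ (r w)) (cong v (q-r w)))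
  }
  where
  Y⊎Z : FinSet
  Y⊎Z = Y ⊎ᶠ Z

  open Coequalizer (coequalizer (index Y⊎Z ∘ inj₁ ∘ f ∘ element X) (index Y⊎Z ∘ inj₂ ∘ g ∘ element X))

  q : ∣ Y ∣ ⊎ ∣ Z ∣ → Fin card
  q = quot ∘ index Y⊎Z

  r : Fin card → ∣ Y ∣ ⊎ ∣ Z ∣
  r = element Y⊎Z ∘ rep

  q-r : ∀ w → q (r w) ≡ w
  q-r w = trans (cong quot (index-element Y⊎Z (rep w))) (quot-rep w)

  r-q : {W : Set} (h : ∣ Y ∣ → W) (k : ∣ Z ∣ → W) → h ∘ f ≗ k ∘ g → ∀ m → [ h , k ]′ (r (q m)) ≡ [ h , k ]′ m
  r-q h k e m = trans (rep-quot ([ h , k ]′ ∘ element Y⊎Z) glued (index Y⊎Z m))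
                      (cong [ h , k ]′ (element-index Y⊎Z m))
    where
    glued : ∀ i → [ h , k ]′ (element Y⊎Z (index Y⊎Z (inj₁ (f (element X i))))) ≡
                  [ h , k ]′ (element Y⊎Z (index Y⊎Z (inj₂ (g (element X i)))))
    glued i = trans (cong [ h , k ]′ (element-index Y⊎Z (inj₁ (f (element X i)))))
             (trans (e (element X i))
                    (sym (cong [ h , k ]′ (element-index Y⊎Z (inj₂ (g (element X i)))))))

  agree : {W : Set} (u v : Fin card → W) → u ∘ q ∘ inj₁ ≗ v ∘ q ∘ inj₁ → u ∘ q ∘ inj₂ ≗ v ∘ q ∘ inj₂ →
          ∀ m → u (q m) ≡ v (q m)
  agree u v e₁ e₂ (inj₁ y) = e₁ y
  agree u v e₁ e₂ (inj₂ z) = e₂ z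

------------------------------------------------------------------------
-- Computons

record Signature : Set₁ where
  field
    n             : ℕ
    ⦃ n-nonZero ⦄ : NonZero n
    Alphabet      : FinSet

  Word : Set
  Word = List ∣ Alphabet ∣

  field
    -- The set of devices consists of the words occurring in the list B, in any order and
    -- with any multiplicity; so f below is word-valued, with f o ∈ B as a separate condition.
    B   : List Word
    ε   : Word
    ε∈B : ε ∈ᴸ B

record Computon (𝕊 : Signature) : Set₁ where
  open Signature 𝕊 using (n; Word; B)
  field
    U P I O : FinSet
    σ : ∣ O ∣ → ∣ U ∣
    t : ∣ O ∣ → ∣ P ∣
    τ : ∣ I ∣ → ∣ U ∣
    s : ∣ I ∣ → ∣ P ∣
    c : ∣ P ∣ → Fin n
    r : ∣ I ∣ → ∣ O ∣
    f : ∣ O ∣ → Word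

  Control : Pred ∣ P ∣ 0ℓ
  Control p = toℕ (c p) ≡ 0

  P⁺ : Pred ∣ P ∣ 0ℓ
  P⁺ p = p ∉ range t

  P⁻ : Pred ∣ P ∣ 0ℓ
  P⁻ p = p ∉ range s

  field
    P-nonempty        : ∣ P ∣
    f∈B               : ∀ o → f o ∈ᴸ B
    σ-surjective      : StrictlySurjective _≡_ σ
    τ-surjective      : StrictlySurjective _≡_ τ
    r-surjective      : StrictlySurjective _≡_ r
    τ-controlled      : ∀ u → u ∈ image τ (Control ∘ s)
    σ-controlled      : ∀ u → u ∈ image σ (Control ∘ t)
    σ∘r≗τ             : σ ∘ r ≗ τ
    control-inport    : ∃ λ p → p ∈ P⁺ × p ∈ Control
    control-outport   : ∃ λ q → q ∈ P⁻ × q ∈ Control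

  -- p• and •p, respectively
  post pre : ∣ P ∣ → Pred ∣ U ∣ 0ℓ
  post p = image τ (λ i → s i ≡ p)
  pre  p = image σ (λ o → t o ≡ p)

record Morphism {𝕊 : Signature} (κ₁ κ₂ : Computon 𝕊) : Set where
  private
    module κ₁ = Computon κ₁
    module κ₂ = Computon κ₂
  field
    mapU : ∣ κ₁.U ∣ → ∣ κ₂.U ∣
    mapP : ∣ κ₁.P ∣ → ∣ κ₂.P ∣
    mapI : ∣ κ₁.I ∣ → ∣ κ₂.I ∣
    mapO : ∣ κ₁.O ∣ → ∣ κ₂.O ∣

  i⃗ : Pred ∣ κ₁.P ∣ 0ℓ
  i⃗ p = Satisfiable (κ₂.pre (mapP p) ∖ image mapU (κ₁.pre p))

  o⃗ : Pred ∣ κ₁.P ∣ 0ℓ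
  o⃗ p = Satisfiable (κ₂.post (mapP p) ∖ image mapU (κ₁.post p))

  field
    map-τ : mapU ∘ κ₁.τ ≗ κ₂.τ ∘ mapI
    map-σ : mapU ∘ κ₁.σ ≗ κ₂.σ ∘ mapO
    map-s : mapP ∘ κ₁.s ≗ κ₂.s ∘ mapI
    map-t : mapP ∘ κ₁.t ≗ κ₂.t ∘ mapO
    map-r : mapO ∘ κ₁.r ≗ κ₂.r ∘ mapI
    map-f : κ₂.f ∘ mapO ≗ κ₁.f
    map-c : κ₂.c ∘ mapP ≗ κ₁.c
    boundary : i⃗ ∪ o⃗ ⊆ κ₁.P⁺ ∪ κ₁.P⁻

record IsMono {𝕊 : Signature} {κ₁ κ₂ : Computon 𝕊} (α : Morphism κ₁ κ₂) : Set where
  open Morphism α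
  field
    mapU-injective : Injective _≡_ _≡_ mapU
    mapP-injective : Injective _≡_ _≡_ mapP
    mapI-injective : Injective _≡_ _≡_ mapI
    mapO-injective : Injective _≡_ _≡_ mapO

infix 4 _≅_

-- Morphisms compose componentwise and are equal when their components agree pointwise.
record _≅_ {𝕊 : Signature} (κ₁ κ₂ : Computon 𝕊) : Set where
  field
    to   : Morphism κ₁ κ₂
    from : Morphism κ₂ κ₁

  private
    module to   = Morphism to
    module from = Morphism from

  field
    from∘toU : from.mapU ∘ to.mapU ≗ id
    from∘toP : from.mapP ∘ to.mapP ≗ id
    from∘toI : from.mapI ∘ to.mapI ≗ id
    from∘toO : from.mapO ∘ to.mapO ≗ id
    to∘fromU : to.mapU ∘ from.mapU ≗ id
    to∘fromP : to.mapP ∘ from.mapP ≗ id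
    to∘fromI : to.mapI ∘ from.mapI ≗ id
    to∘fromO : to.mapO ∘ from.mapO ≗ id

record IsTrivial {𝕊 : Signature} (κ : Computon 𝕊) : Set where
  open Computon κ
  field
    U-empty : Empty U
    I-empty : Empty I
    O-empty : Empty O

record IsUnit {𝕊 : Signature} (κ : Computon 𝕊) : Set where
  field
    isTrivial  : IsTrivial κ
    singlePort : size (Computon.P κ) ≡ 1

------------------------------------------------------------------------
-- Sequencing

record SequentiableSpan {𝕊 : Signature} (κ₁ κ₂ : Computon 𝕊) : Set₁ where
  field
    κ₀ : Computon 𝕊
    α₁ : Morphism κ₀ κ₁
    α₂ : Morphism κ₀ κ₂
    κ₀-trivial : IsTrivial κ₀
    α₁-mono    : IsMono α₁
    α₂-mono    : IsMono α₂
    α₁-outports : range (Morphism.mapP α₁) ⊆ Computon.P⁻ κ₁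
    α₂-inports  : range (Morphism.mapP α₂) ⊆ Computon.P⁺ κ₂

  Total : Set
  Total = range (Morphism.mapP α₁) ≐ Computon.P⁻ κ₁ × range (Morphism.mapP α₂) ≐ Computon.P⁺ κ₂

  Partial : Set
  Partial = ¬ Total

open SequentiableSpan public using (Total; Partial)

-- Every sequentiable span is total or partial.
total? : {𝕊 : Signature} {κ₁ κ₂ : Computon 𝕊} (ρ : SequentiableSpan κ₁ κ₂) → Dec (Total ρ)
total? {κ₁ = κ₁} {κ₂} ρ =
  ≐? κ₁.P (range? κ₀.P κ₁.P α₁.mapP) (¬? ∘ range? κ₁.I κ₁.P κ₁.s)
    ×-dec
  ≐? κ₂.P (range? κ₀.P κ₂.P α₂.mapP) (¬? ∘ range? κ₂.O κ₂.P κ₂.t)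
  where
  open SequentiableSpan ρ
  module κ₀ = Computon κ₀
  module κ₁ = Computon κ₁
  module κ₂ = Computon κ₂
  module α₁ = Morphism α₁
  module α₂ = Morphism α₂

  ⊆? : (X : FinSet) {Q R : Pred ∣ X ∣ 0ℓ} → Decidable Q → Decidable R → Dec (Q ⊆ R)
  ⊆? X Q? R? = map′ (λ h {x} → h x) (λ h x → h {x}) (∀? X (λ x → Q? x →-dec R? x))

  ≐? : (X : FinSet) {Q R : Pred ∣ X ∣ 0ℓ} → Decidable Q → Decidable R → Dec (Q ≐ R)
  ≐? X Q? R? = ⊆? X Q? R? ×-dec ⊆? X R? Q?

-- The componentwise pushout of a sequentiable span, with the induced structure functions.
module _ {𝕊 : Signature} {κ₁ κ₂ : Computon 𝕊} (ρ : SequentiableSpan κ₁ κ₂) where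
  open SequentiableSpan ρ
  private
    module κ₀ = Computon κ₀
    module κ₁ = Computon κ₁
    module κ₂ = Computon κ₂
    module α₁ = Morphism α₁
    module α₂ = Morphism α₂

  module pushU = Pushout (pushoutOf {κ₀.U} {κ₁.U} {κ₂.U} α₁.mapU α₂.mapU)
  module pushP = Pushout (pushoutOf {κ₀.P} {κ₁.P} {κ₂.P} α₁.mapP α₂.mapP)
  module pushI = Pushout (pushoutOf {κ₀.I} {κ₁.I} {κ₂.I} α₁.mapI α₂.mapI)
  module pushO = Pushout (pushoutOf {κ₀.O} {κ₁.O} {κ₂.O} α₁.mapO α₂.mapO)

  private
    σ-compatible : pushU.in₁ ∘ κ₁.σ ∘ α₁.mapO ≗ pushU.in₂ ∘ κ₂.σ ∘ α₂.mapO
    σ-compatible x = trans (cong pushU.in₁ (sym (α₁.map-σ x)))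
                         (trans (pushU.commute (κ₀.σ x)) (cong pushU.in₂ (α₂.map-σ x)))

  push-σ : ∣ pushO.apex ∣ → ∣ pushU.apex ∣
  push-σ = pushO.copair (pushU.in₁ ∘ κ₁.σ) (pushU.in₂ ∘ κ₂.σ) σ-compatible

  push-σ-in₁ : push-σ ∘ pushO.in₁ ≗ pushU.in₁ ∘ κ₁.σ
  push-σ-in₁ = pushO.copair₁ (pushU.in₁ ∘ κ₁.σ) (pushU.in₂ ∘ κ₂.σ) σ-compatible

  push-σ-in₂ : push-σ ∘ pushO.in₂ ≗ pushU.in₂ ∘ κ₂.σ
  push-σ-in₂ = pushO.copair₂ (pushU.in₁ ∘ κ₁.σ) (pushU.in₂ ∘ κ₂.σ) σ-compatible

  private
    t-compatible : pushP.in₁ ∘ κ₁.t ∘ α₁.mapO ≗ pushP.in₂ ∘ κ₂.t ∘ α₂.mapO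
    t-compatible x = trans (cong pushP.in₁ (sym (α₁.map-t x)))
                         (trans (pushP.commute (κ₀.t x)) (cong pushP.in₂ (α₂.map-t x)))

  push-t : ∣ pushO.apex ∣ → ∣ pushP.apex ∣
  push-t = pushO.copair (pushP.in₁ ∘ κ₁.t) (pushP.in₂ ∘ κ₂.t) t-compatible

  push-t-in₁ : push-t ∘ pushO.in₁ ≗ pushP.in₁ ∘ κ₁.t
  push-t-in₁ = pushO.copair₁ (pushP.in₁ ∘ κ₁.t) (pushP.in₂ ∘ κ₂.t) t-compatible

  push-t-in₂ : push-t ∘ pushO.in₂ ≗ pushP.in₂ ∘ κ₂.t
  push-t-in₂ = pushO.copair₂ (pushP.in₁ ∘ κ₁.t) (pushP.in₂ ∘ κ₂.t) t-compatible

  private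
    τ-compatible : pushU.in₁ ∘ κ₁.τ ∘ α₁.mapI ≗ pushU.in₂ ∘ κ₂.τ ∘ α₂.mapI
    τ-compatible x = trans (cong pushU.in₁ (sym (α₁.map-τ x)))
                         (trans (pushU.commute (κ₀.τ x)) (cong pushU.in₂ (α₂.map-τ x)))

  push-τ : ∣ pushI.apex ∣ → ∣ pushU.apex ∣
  push-τ = pushI.copair (pushU.in₁ ∘ κ₁.τ) (pushU.in₂ ∘ κ₂.τ) τ-compatible

  push-τ-in₁ : push-τ ∘ pushI.in₁ ≗ pushU.in₁ ∘ κ₁.τ
  push-τ-in₁ = pushI.copair₁ (pushU.in₁ ∘ κ₁.τ) (pushU.in₂ ∘ κ₂.τ) τ-compatible

  push-τ-in₂ : push-τ ∘ pushI.in₂ ≗ pushU.in₂ ∘ κ₂.τ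
  push-τ-in₂ = pushI.copair₂ (pushU.in₁ ∘ κ₁.τ) (pushU.in₂ ∘ κ₂.τ) τ-compatible

  private
    s-compatible : pushP.in₁ ∘ κ₁.s ∘ α₁.mapI ≗ pushP.in₂ ∘ κ₂.s ∘ α₂.mapI
    s-compatible x = trans (cong pushP.in₁ (sym (α₁.map-s x)))
                         (trans (pushP.commute (κ₀.s x)) (cong pushP.in₂ (α₂.map-s x)))

  push-s : ∣ pushI.apex ∣ → ∣ pushP.apex ∣
  push-s = pushI.copair (pushP.in₁ ∘ κ₁.s) (pushP.in₂ ∘ κ₂.s) s-compatible

  push-s-in₁ : push-s ∘ pushI.in₁ ≗ pushP.in₁ ∘ κ₁.s
  push-s-in₁ = pushI.copair₁ (pushP.in₁ ∘ κ₁.s) (pushP.in₂ ∘ κ₂.s) s-compatible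

  push-s-in₂ : push-s ∘ pushI.in₂ ≗ pushP.in₂ ∘ κ₂.s
  push-s-in₂ = pushI.copair₂ (pushP.in₁ ∘ κ₁.s) (pushP.in₂ ∘ κ₂.s) s-compatible

  private
    r-compatible : pushO.in₁ ∘ κ₁.r ∘ α₁.mapI ≗ pushO.in₂ ∘ κ₂.r ∘ α₂.mapI
    r-compatible x = trans (cong pushO.in₁ (sym (α₁.map-r x)))
                         (trans (pushO.commute (κ₀.r x)) (cong pushO.in₂ (α₂.map-r x)))

  push-r : ∣ pushI.apex ∣ → ∣ pushO.apex ∣
  push-r = pushI.copair (pushO.in₁ ∘ κ₁.r) (pushO.in₂ ∘ κ₂.r) r-compatible

  push-r-in₁ : push-r ∘ pushI.in₁ ≗ pushO.in₁ ∘ κ₁.r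
  push-r-in₁ = pushI.copair₁ (pushO.in₁ ∘ κ₁.r) (pushO.in₂ ∘ κ₂.r) r-compatible

  push-r-in₂ : push-r ∘ pushI.in₂ ≗ pushO.in₂ ∘ κ₂.r
  push-r-in₂ = pushI.copair₂ (pushO.in₁ ∘ κ₁.r) (pushO.in₂ ∘ κ₂.r) r-compatible

  private
    c-compatible : κ₁.c ∘ α₁.mapP ≗ κ₂.c ∘ α₂.mapP
    c-compatible x = trans (α₁.map-c x) (sym (α₂.map-c x))

  push-c : ∣ pushP.apex ∣ → Fin (Signature.n 𝕊)
  push-c = pushP.copair κ₁.c κ₂.c c-compatible

  push-c-in₁ : push-c ∘ pushP.in₁ ≗ κ₁.c
  push-c-in₁ = pushP.copair₁ κ₁.c κ₂.c c-compatible

  push-c-in₂ : push-c ∘ pushP.in₂ ≗ κ₂.c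
  push-c-in₂ = pushP.copair₂ κ₁.c κ₂.c c-compatible

  private
    f-compatible : κ₁.f ∘ α₁.mapO ≗ κ₂.f ∘ α₂.mapO
    f-compatible x = trans (α₁.map-f x) (sym (α₂.map-f x))

  push-f : ∣ pushO.apex ∣ → Signature.Word 𝕊
  push-f = pushO.copair κ₁.f κ₂.f f-compatible

  push-f-in₁ : push-f ∘ pushO.in₁ ≗ κ₁.f
  push-f-in₁ = pushO.copair₁ κ₁.f κ₂.f f-compatible

  push-f-in₂ : push-f ∘ pushO.in₂ ≗ κ₂.f
  push-f-in₂ = pushO.copair₂ κ₁.f κ₂.f f-compatible

  private
    PushControl : Pred ∣ pushP.apex ∣ 0ℓ
    PushControl p = toℕ (push-c p) ≡ 0

    control₁ : ∀ {p} → p ∈ κ₁.Control → pushP.in₁ p ∈ PushControl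
    control₁ {p} e = trans (cong toℕ (push-c-in₁ p)) e

    control₂ : ∀ {p} → p ∈ κ₂.Control → pushP.in₂ p ∈ PushControl
    control₂ {p} e = trans (cong toℕ (push-c-in₂ p)) e

    push-f∈B : ∀ o → push-f o ∈ᴸ Signature.B 𝕊
    push-f∈B o with pushO.cover o
    ... | inj₁ (x , refl) = subst (_∈ᴸ Signature.B 𝕊) (sym (push-f-in₁ x)) (κ₁.f∈B x)
    ... | inj₂ (x , refl) = subst (_∈ᴸ Signature.B 𝕊) (sym (push-f-in₂ x)) (κ₂.f∈B x)

    push-r-surjective : StrictlySurjective _≡_ push-r
    push-r-surjective o with pushO.cover o
    ... | inj₁ (x , refl) = let i , e = κ₁.r-surjective x in pushI.in₁ i , trans (push-r-in₁ i) (cong pushO.in₁ e)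
    ... | inj₂ (x , refl) = let i , e = κ₂.r-surjective x in pushI.in₂ i , trans (push-r-in₂ i) (cong pushO.in₂ e)

    push-τ-controlled : ∀ u → u ∈ image push-τ (PushControl ∘ push-s)
    push-τ-controlled u with pushU.cover u
    ... | inj₁ (x , refl) =
      let i , e₀ , e = κ₁.τ-controlled x in
      pushI.in₁ i , subst PushControl (sym (push-s-in₁ i)) (control₁ e₀) , trans (push-τ-in₁ i) (cong pushU.in₁ e)
    ... | inj₂ (x , refl) =
      let i , e₀ , e = κ₂.τ-controlled x in
      pushI.in₂ i , subst PushControl (sym (push-s-in₂ i)) (control₂ e₀) , trans (push-τ-in₂ i) (cong pushU.in₂ e)

    push-σ-controlled : ∀ u → u ∈ image push-σ (PushControl ∘ push-t)
    push-σ-controlled u with pushU.cover u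
    ... | inj₁ (x , refl) =
      let o , e₀ , e = κ₁.σ-controlled x in
      pushO.in₁ o , subst PushControl (sym (push-t-in₁ o)) (control₁ e₀) , trans (push-σ-in₁ o) (cong pushU.in₁ e)
    ... | inj₂ (x , refl) =
      let o , e₀ , e = κ₂.σ-controlled x in
      pushO.in₂ o , subst PushControl (sym (push-t-in₂ o)) (control₂ e₀) , trans (push-σ-in₂ o) (cong pushU.in₂ e)

    push-σ∘r≗τ : push-σ ∘ push-r ≗ push-τ
    push-σ∘r≗τ = pushI.unique (push-σ ∘ push-r) push-τ
      (λ i → trans (cong push-σ (push-r-in₁ i))
            (trans (push-σ-in₁ (κ₁.r i))
            (trans (cong pushU.in₁ (κ₁.σ∘r≗τ i)) (sym (push-τ-in₁ i)))))
      (λ i → trans (cong push-σ (push-r-in₂ i))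
            (trans (push-σ-in₂ (κ₂.r i))
            (trans (cong pushU.in₂ (κ₂.σ∘r≗τ i)) (sym (push-τ-in₂ i)))))

    push-control-inport : ∃ λ p → p ∉ range push-t × p ∈ PushControl
    push-control-inport = let p , p∈P⁺ , e = κ₁.control-inport in
      pushP.in₁ p , (λ (o , e′) → avoid p p∈P⁺ o e′ (pushO.cover o)) , control₁ e
      where
      avoid : ∀ p → p ∈ κ₁.P⁺ → ∀ o → push-t o ≡ pushP.in₁ p → ¬ (o ∈ range pushO.in₁ ∪ range pushO.in₂)
      avoid p p∈P⁺ o e (inj₁ (x , refl)) =
        p∈P⁺ (x , pushP.in₁-injective (IsMono.mapP-injective α₂-mono) (trans (sym (push-t-in₁ x)) e))
      avoid p p∈P⁺ o e (inj₂ (x , refl)) =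
        α₂-inports (pushP.in₁≡in₂⇒∈range₂ (trans (sym e) (push-t-in₂ x))) (x , refl)

    push-control-outport : ∃ λ q → q ∉ range push-s × q ∈ PushControl
    push-control-outport = let q , q∈P⁻ , e = κ₂.control-outport in
      pushP.in₂ q , (λ (i , e′) → avoid q q∈P⁻ i e′ (pushI.cover i)) , control₂ e
      where
      avoid : ∀ q → q ∈ κ₂.P⁻ → ∀ i → push-s i ≡ pushP.in₂ q → ¬ (i ∈ range pushI.in₁ ∪ range pushI.in₂)
      avoid q q∈P⁻ i e (inj₁ (x , refl)) =
        α₁-outports (pushP.in₁≡in₂⇒∈range₁ (trans (sym (push-s-in₁ x)) e)) (x , refl)
      avoid q q∈P⁻ i e (inj₂ (x , refl)) =
        q∈P⁻ (x , pushP.in₂-injective (IsMono.mapP-injective α₁-mono) (trans (sym (push-s-in₂ x)) e))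

  pushout : Computon 𝕊
  pushout = record
    { U = pushU.apex
    ; P = pushP.apex
    ; I = pushI.apex
    ; O = pushO.apex
    ; σ = push-σ
    ; t = push-t
    ; τ = push-τ
    ; s = push-s
    ; c = push-c
    ; r = push-r
    ; f = push-f
    ; P-nonempty      = pushP.in₁ κ₁.P-nonempty
    ; f∈B             = push-f∈B
    ; σ-surjective    = λ u → let o , _ , e = push-σ-controlled u in o , e
    ; τ-surjective    = λ u → let i , _ , e = push-τ-controlled u in i , e
    ; r-surjective    = push-r-surjective
    ; τ-controlled    = push-τ-controlled
    ; σ-controlled    = push-σ-controlled
    ; σ∘r≗τ           = push-σ∘r≗τ
    ; control-inport  = push-control-inport
    ; control-outport = push-control-outport
    }

totalSequential : {𝕊 : Signature} (κ₁ κ₂ : Computon 𝕊) (ρ : SequentiableSpan κ₁ κ₂) → Total ρ → Computon 𝕊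
totalSequential κ₁ κ₂ ρ _ = pushout ρ

partialSequential : {𝕊 : Signature} (κ₁ κ₂ : Computon 𝕊) (ρ : SequentiableSpan κ₁ κ₂) → Partial ρ → Computon 𝕊
partialSequential κ₁ κ₂ ρ _ = pushout ρ

infix 5 totalSequential partialSequential

syntax totalSequential   κ₁ κ₂ ρ total   = κ₁ ⊵[ ρ , total ] κ₂
syntax partialSequential κ₁ κ₂ ρ partial = κ₁ ▷[ ρ , partial ] κ₂

{-# OPTIONS --safe #-}
-- A unit computon has no units and flows and a single port, so a monomorphism from a trivial
-- computon into it is bijective on every component. A pushout of sets along a bijection is a
-- bijection on the other side, hence the coprojection of κ₁ into the pushout is componentwise
-- bijective; it commutes with the structure functions, and such a map is an isomorphism (the
-- boundary condition holds vacuously in both directions).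
module Submission where

open import Defs
open import Data.Fin using (Fin; zero)
open import Data.Product using (_×_; _,_; proj₁; proj₂)
open import Data.Sum using (inj₁; inj₂)
open import Function using (_∘_; id; _↔_; Inverse; mk↔ₛ′; Injective; StrictlySurjective)
open import Function.Construct.Symmetry using (↔-sym)
open import Relation.Binary.PropositionalEquality using (_≡_; _≗_; refl; sym; trans; cong)
open import Relation.Nullary using (contradiction; Irrelevant)

open FinSet using (size; index; element; element-index) renaming (Carrier to ∣_∣)

size≡1⇒irrelevant : (X : FinSet) → size X ≡ 1 → Irrelevant ∣ X ∣
size≡1⇒irrelevant X e x y =
  trans (sym (element-index X x)) (trans (cong (element X) (Fin-irrelevant e (index X x) (index X y))) (element-index X y))
  where
  Fin-irrelevant : ∀ {k} → k ≡ 1 → Irrelevant (Fin k)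
  Fin-irrelevant refl zero zero = refl

module _ {X Y Z : FinSet} {f : ∣ X ∣ → ∣ Y ∣} {g : ∣ X ∣ → ∣ Z ∣} (P : Pushout {X} {Y} {Z} f g) where
  open Pushout P

  -- Gives the `in₁` version of the bijection below by symmetry.
  flip : Pushout {X} {Z} {Y} g f
  flip = record
    { apex    = apex
    ; in₁     = in₂
    ; in₂     = in₁
    ; commute = sym ∘ commute
    ; copair  = λ h k e → copair k h (sym ∘ e)
    ; copair₁ = λ h k e → copair₂ k h (sym ∘ e)
    ; copair₂ = λ h k e → copair₁ k h (sym ∘ e)
    ; unique  = λ u v e₁ e₂ → unique u v e₂ e₁
    }

  -- The inverse comes from the universal property: copair `g ∘ f⁻¹` with `id`. One composite is
  -- then the rule `copair₂`, the other is checked on both coprojections by `unique`.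
  in₂-↔ : Injective _≡_ _≡_ f → StrictlySurjective _≡_ f → ∣ Z ∣ ↔ ∣ apex ∣
  in₂-↔ f-inj f-surj = mk↔ₛ′ in₂ out in₂∘out (copair₂ (g ∘ f⁻¹) id compatible)
    where
    f⁻¹ : ∣ Y ∣ → ∣ X ∣
    f⁻¹ = proj₁ ∘ f-surj

    f∘f⁻¹ : f ∘ f⁻¹ ≗ id
    f∘f⁻¹ = proj₂ ∘ f-surj

    compatible : g ∘ f⁻¹ ∘ f ≗ g
    -- Surjectivity makes `f⁻¹` a section of `f`; injectivity makes it a retraction as well.
    compatible x = cong g (f-inj (f∘f⁻¹ (f x)))

    out : ∣ apex ∣ → ∣ Z ∣
    out = copair (g ∘ f⁻¹) id compatible

    in₂∘out : in₂ ∘ out ≗ id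
    in₂∘out = unique (in₂ ∘ out) id
      -- The gluing at `f⁻¹ y` turns `in₂ (g (f⁻¹ y))` into `in₁ (f (f⁻¹ y))`.
      (λ y → trans (cong in₂ (copair₁ (g ∘ f⁻¹) id compatible y))
            (trans (sym (commute (f⁻¹ y))) (cong in₁ (f∘f⁻¹ y))))
      (λ z → cong in₂ (copair₂ (g ∘ f⁻¹) id compatible z))

in₁-↔ : {X Y Z : FinSet} {f : ∣ X ∣ → ∣ Y ∣} {g : ∣ X ∣ → ∣ Z ∣} (P : Pushout {X} {Y} {Z} f g) →
        Injective _≡_ _≡_ g → StrictlySurjective _≡_ g → ∣ Y ∣ ↔ ∣ Pushout.apex P ∣
in₁-↔ P = in₂-↔ (flip P)

-- There is no boundary field: `morphism` derives that condition from bijectivity, and what remains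
-- passes to inverses by equational reasoning alone.
record ComponentwiseBijection {𝕊 : Signature} (κ₁ κ₂ : Computon 𝕊) : Set where
  private
    module κ₁ = Computon κ₁
    module κ₂ = Computon κ₂
  field
    bijU : ∣ κ₁.U ∣ ↔ ∣ κ₂.U ∣
    bijP : ∣ κ₁.P ∣ ↔ ∣ κ₂.P ∣
    bijI : ∣ κ₁.I ∣ ↔ ∣ κ₂.I ∣
    bijO : ∣ κ₁.O ∣ ↔ ∣ κ₂.O ∣

  module U = Inverse bijU
  module P = Inverse bijP
  module I = Inverse bijI
  module O = Inverse bijO

  field
    to-τ : U.to ∘ κ₁.τ ≗ κ₂.τ ∘ I.to
    to-σ : U.to ∘ κ₁.σ ≗ κ₂.σ ∘ O.to
    to-s : P.to ∘ κ₁.s ≗ κ₂.s ∘ I.to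
    to-t : P.to ∘ κ₁.t ≗ κ₂.t ∘ O.to
    to-r : O.to ∘ κ₁.r ≗ κ₂.r ∘ I.to
    to-f : κ₂.f ∘ O.to ≗ κ₁.f
    to-c : κ₂.c ∘ P.to ≗ κ₁.c

inverse-square : {A B C D : Set} (φ : A ↔ B) (ψ : C ↔ D) {h : A → C} {k : B → D} →
                 Inverse.to ψ ∘ h ≗ k ∘ Inverse.to φ → Inverse.from ψ ∘ k ≗ h ∘ Inverse.from φ
inverse-square φ ψ {h} {k} e b =
  trans (cong (ψ.from ∘ k) (sym (φ.strictlyInverseˡ b)))
 (trans (cong ψ.from (sym (e (φ.from b)))) (ψ.strictlyInverseʳ (h (φ.from b))))
  where
  module φ = Inverse φ
  module ψ = Inverse ψ

inverse-triangle : {A B C : Set} (φ : A ↔ B) {h : A → C} {k : B → C} →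
                   k ∘ Inverse.to φ ≗ h → h ∘ Inverse.from φ ≗ k
inverse-triangle φ {k = k} e b =
  trans (sym (e (Inverse.from φ b))) (cong k (Inverse.strictlyInverseˡ φ b))

module _ {𝕊 : Signature} {κ₁ κ₂ : Computon 𝕊} where

  inverse : ComponentwiseBijection κ₁ κ₂ → ComponentwiseBijection κ₂ κ₁
  inverse φ = record
    { bijU = ↔-sym bijU
    ; bijP = ↔-sym bijP
    ; bijI = ↔-sym bijI
    ; bijO = ↔-sym bijO
    ; to-τ = inverse-square bijI bijU to-τ
    ; to-σ = inverse-square bijO bijU to-σ
    ; to-s = inverse-square bijI bijP to-s
    ; to-t = inverse-square bijO bijP to-t
    ; to-r = inverse-square bijI bijO to-r
    ; to-f = inverse-triangle bijO to-f
    ; to-c = inverse-triangle bijP to-c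
    }
    where open ComponentwiseBijection φ

  morphism : ComponentwiseBijection κ₁ κ₂ → Morphism κ₁ κ₂
  morphism φ = record
    { mapU  = U.to
    ; mapP  = P.to
    ; mapI  = I.to
    ; mapO  = O.to
    ; map-τ = to-τ
    ; map-σ = to-σ
    ; map-s = to-s
    ; map-t = to-t
    ; map-r = to-r
    ; map-f = to-f
    ; map-c = to-c
    -- Both `i⃗` and `o⃗` are empty. A flow `o` or `i` at the image port pulls back along the
    -- inverse to a flow at the original port, and the unit of that flow maps to the unit assumed to
    -- lie outside the image.
    ; boundary = λ where
        (inj₁ (_ , (o , t-o , refl) , ∉image)) → contradiction
          (_ , (O.from o , trans (sym (φ⁻¹.to-t o)) (P.inverseʳ t-o) , refl) , U.inverseˡ (sym (φ⁻¹.to-σ o)))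
          ∉image
        (inj₂ (_ , (i , s-i , refl) , ∉image)) → contradiction
          (_ , (I.from i , trans (sym (φ⁻¹.to-s i)) (P.inverseʳ s-i) , refl) , U.inverseˡ (sym (φ⁻¹.to-τ i)))
          ∉image
    }
    where
    open ComponentwiseBijection φ
    module φ⁻¹ = ComponentwiseBijection (inverse φ)

componentwiseBijection⇒≅ : {𝕊 : Signature} {κ₁ κ₂ : Computon 𝕊} → ComponentwiseBijection κ₁ κ₂ → κ₁ ≅ κ₂
componentwiseBijection⇒≅ φ = record
  { to       = morphism φ
  ; from     = morphism (inverse φ)
  ; from∘toU = U.strictlyInverseʳ
  ; from∘toP = P.strictlyInverseʳ
  ; from∘toI = I.strictlyInverseʳ
  ; from∘toO = O.strictlyInverseʳ
  ; to∘fromU = U.strictlyInverseˡ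
  ; to∘fromP = P.strictlyInverseˡ
  ; to∘fromI = I.strictlyInverseˡ
  ; to∘fromO = O.strictlyInverseˡ
  }
  where open ComponentwiseBijection φ

record IsSurjective {𝕊 : Signature} {κ₁ κ₂ : Computon 𝕊} (α : Morphism κ₁ κ₂) : Set where
  open Morphism α
  field
    mapU-surjective : StrictlySurjective _≡_ mapU
    mapP-surjective : StrictlySurjective _≡_ mapP
    mapI-surjective : StrictlySurjective _≡_ mapI
    mapO-surjective : StrictlySurjective _≡_ mapO

morphism-to-unit-surjective : {𝕊 : Signature} {κ₀ κ : Computon 𝕊} → IsUnit κ →
                              (α : Morphism κ₀ κ) → IsSurjective α
morphism-to-unit-surjective {κ₀ = κ₀} {κ} unit α = record
  { mapU-surjective = λ u → contradiction u U-empty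
  -- Every computon has a port, and the image of any port of `κ₀` must be the only port of `κ`.
  ; mapP-surjective = λ p → Computon.P-nonempty κ₀ , size≡1⇒irrelevant (Computon.P κ) singlePort _ p
  ; mapI-surjective = λ i → contradiction i I-empty
  ; mapO-surjective = λ o → contradiction o O-empty
  }
  where
  open IsUnit unit
  open IsTrivial isTrivial

module _ {𝕊 : Signature} {κ₁ κ₂ : Computon 𝕊} (ρ : SequentiableSpan κ₁ κ₂) where
  open SequentiableSpan ρ

  private
    module κ₀ = Computon κ₀
    module κ₁ = Computon κ₁
    module κ₂ = Computon κ₂
    module α₁ = Morphism α₁
    module α₂ = Morphism α₂

    U-pushout : Pushout {κ₀.U} {κ₁.U} {κ₂.U} α₁.mapU α₂.mapU
    U-pushout = pushoutOf α₁.mapU α₂.mapU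

    P-pushout : Pushout {κ₀.P} {κ₁.P} {κ₂.P} α₁.mapP α₂.mapP
    P-pushout = pushoutOf α₁.mapP α₂.mapP

    I-pushout : Pushout {κ₀.I} {κ₁.I} {κ₂.I} α₁.mapI α₂.mapI
    I-pushout = pushoutOf α₁.mapI α₂.mapI

    O-pushout : Pushout {κ₀.O} {κ₁.O} {κ₂.O} α₁.mapO α₂.mapO
    O-pushout = pushoutOf α₁.mapO α₂.mapO

  -- With injectivity from `α₁-mono`, every component of `α₁` is bijective, hence so is every `in₂`.
  -- The bijection is built from `κ₂` to the pushout, the direction in which the induced structure
  -- functions compute, and then inverted.
  α₁-surjective⇒pushout≅κ₂ : IsSurjective α₁ → pushout ρ ≅ κ₂
  α₁-surjective⇒pushout≅κ₂ surjective = componentwiseBijection⇒≅ (inverse record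
    { bijU = in₂-↔ U-pushout mapU-injective mapU-surjective
    ; bijP = in₂-↔ P-pushout mapP-injective mapP-surjective
    ; bijI = in₂-↔ I-pushout mapI-injective mapI-surjective
    ; bijO = in₂-↔ O-pushout mapO-injective mapO-surjective
    ; to-τ = sym ∘ push-τ-in₂ ρ
    ; to-σ = sym ∘ push-σ-in₂ ρ
    ; to-s = sym ∘ push-s-in₂ ρ
    ; to-t = sym ∘ push-t-in₂ ρ
    ; to-r = sym ∘ push-r-in₂ ρ
    ; to-f = push-f-in₂ ρ
    ; to-c = push-c-in₂ ρ
    })
    where
    open IsMono α₁-mono
    open IsSurjective surjective

  α₂-surjective⇒pushout≅κ₁ : IsSurjective α₂ → pushout ρ ≅ κ₁
  α₂-surjective⇒pushout≅κ₁ surjective = componentwiseBijection⇒≅ (inverse record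
    { bijU = in₁-↔ U-pushout mapU-injective mapU-surjective
    ; bijP = in₁-↔ P-pushout mapP-injective mapP-surjective
    ; bijI = in₁-↔ I-pushout mapI-injective mapI-surjective
    ; bijO = in₁-↔ O-pushout mapO-injective mapO-surjective
    ; to-τ = sym ∘ push-τ-in₁ ρ
    ; to-σ = sym ∘ push-σ-in₁ ρ
    ; to-s = sym ∘ push-s-in₁ ρ
    ; to-t = sym ∘ push-t-in₁ ρ
    ; to-r = sym ∘ push-r-in₁ ρ
    ; to-f = push-f-in₁ ρ
    ; to-c = push-c-in₁ ρ
    })
    where
    open IsMono α₂-mono
    open IsSurjective surjective

theorem5 : (𝕊 : Signature) (κ : Computon 𝕊) → IsUnit κ → (κ₁ : Computon 𝕊) →
    ((ρ₁ : SequentiableSpan κ κ₁) →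
    ((total : Total ρ₁) → (κ ⊵[ ρ₁ , total ] κ₁) ≅ κ₁) ×
    ((partial : Partial ρ₁) → (κ ▷[ ρ₁ , partial ] κ₁) ≅ κ₁)) ×
    ((ρ₂ : SequentiableSpan κ₁ κ) →
    ((total : Total ρ₂) → (κ₁ ⊵[ ρ₂ , total ] κ) ≅ κ₁) ×
    ((partial : Partial ρ₂) → (κ₁ ▷[ ρ₂ , partial ] κ) ≅ κ₁))
theorem5 𝕊 κ unit κ₁ =
  -- Total and partial composites are both `pushout ρ` by definition, so one isomorphism serves both
  -- cases.
  (λ ρ₁ → (λ _ → leftIdentity ρ₁) , (λ _ → leftIdentity ρ₁)) ,
  (λ ρ₂ → (λ _ → rightIdentity ρ₂) , (λ _ → rightIdentity ρ₂))
  where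
  leftIdentity : (ρ : SequentiableSpan κ κ₁) → pushout ρ ≅ κ₁
  leftIdentity ρ = α₁-surjective⇒pushout≅κ₂ ρ (morphism-to-unit-surjective unit (SequentiableSpan.α₁ ρ))

  rightIdentity : (ρ : SequentiableSpan κ₁ κ) → pushout ρ ≅ κ₁
  rightIdentity ρ = α₂-surjective⇒pushout≅κ₁ ρ (morphism-to-unit-surjective unit (SequentiableSpan.α₂ ρ))
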